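{- Let $G$ be a graph, let $k\ge 1$ be an integer, and let $S_1$ and $S_2$ be two disjoint subsets of $V(G)$ such that $S_1$ and $S_2$ are $k$-linked. If each $S_i$ has a subset $T_i$ of size $k-1$, for $i\in\{1,2\}$, such that $T_1$ and $T_2$ are $(k-1)$-linked, then there is a vertex $s_i\in S_i\setminus T_i$ for each $i\in\{1,2\}$ such that $T_1\cup\{s_1\}$ and $T_2\cup\{s_2\}$ are $k$-linked.
   Context: Graphs are finite and simple. For an integer $m\ge 0$, two disjoint vertex subsets $A_1$ and $A_2$ of a graph $G$ are $m$-linked (in $G$) if there exist $m$ pairwise vertex-disjoint paths in $G$ joining $m$ distinct vertices of $A_1$ to $m$ distinct vertices of $A_2$ such that each of the $m$ paths meets $A_i$ in exactly one vertex for each $i\in\{1,2\}$. -}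

module Defs where

open import Data.Fin.Base using (Fin)
open import Data.Fin.Subset using (Subset; _∈_)
open import Data.List.Base using (List; []; _∷_)
import Data.List.Membership.Propositional as List
open import Data.List.Relation.Unary.Unique.Propositional using (Unique)
open import Data.Nat.Base using (ℕ)
open import Data.Product using (_×_; ∃!)
open import Level using (0ℓ)
open import Relation.Binary.Construct.Closure.ReflexiveTransitive using (Star; ε; _◅_)
open import Relation.Binary.Core using (Rel)
open import Relation.Binary.Definitions using (Symmetric; Irreflexive; Decidable)
open import Relation.Binary.PropositionalEquality.Core using (_≡_; _≢_)
open import Relation.Nullary.Negation.Core using (¬_)

-- The vertex set of a finite simple graph is taken to be Fin n.  Decidability
-- of adjacency is what classical logic provides for free.
record Graph (n : ℕ) : Set₁ where
  field
    Adj    : Rel (Fin n) 0ℓ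
    sym    : Symmetric Adj
    irrefl : Irreflexive _≡_ Adj
    _adj?_ : Decidable Adj

module _ {n : ℕ} (G : Graph n) where
  open Graph G

  Walk : Rel (Fin n) 0ℓ
  Walk = Star Adj

  walkVertices : ∀ {u v} → Walk u v → List (Fin n)
  walkVertices {u} ε       = u ∷ []
  walkVertices {u} (_ ◅ w) = u ∷ walkVertices w

  record Path : Set where
    field
      {source target} : Fin n
      walk            : Walk source target
      unique          : Unique (walkVertices walk)

    vertices : List (Fin n)
    vertices = walkVertices walk

  open Path

  VertexDisjoint : Path → Path → Set
  VertexDisjoint P Q = ∀ {v} → v List.∈ vertices P → ¬ (v List.∈ vertices Q)

  MeetsOnce : Path → Subset n → Set
  MeetsOnce P A = ∃! _≡_ λ v → v List.∈ vertices P × v ∈ A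

  -- Meant for disjoint A₁ and A₂.  The m sources (and the m targets) are
  -- distinct because the paths are pairwise vertex-disjoint.
  record Linked (m : ℕ) (A₁ A₂ : Subset n) : Set where
    field
      path     : Fin m → Path
      source∈  : ∀ i → source (path i) ∈ A₁
      target∈  : ∀ i → target (path i) ∈ A₂
      disjoint : ∀ {i j} → i ≢ j → VertexDisjoint (path i) (path j)
      once₁    : ∀ i → MeetsOnce (path i) A₁
      once₂    : ∀ i → MeetsOnce (path i) A₂

{-# OPTIONS --safe #-}

-- Encode a linkage by a partial injection M of the vertex set that sends every
-- vertex of a path to the next one and fixes the vertices on no path: M is
-- undefined exactly at the targets and misses exactly the sources (Ingleton and
-- Piff).  Let M and N encode the linkages of T₁, T₂ and of S₁, S₂.  The orbits of
-- N ∘ M⁻¹ starting at the k sources of N have distinct ends, and an orbit stops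
-- only in T₁ or at some r = M b with b a target of N.  As ∣ T₁ ∣ < k, some orbit,
-- from a to r say, is of the second kind.  Replacing M by N at the M-preimages of
-- this orbit gives a partial injection undefined at T₂ ∪ ⁅ b ⁆ and missing
-- T₁ ∪ ⁅ a ⁆.
module Submission where

open import Defs
open import Data.Fin.Base using (Fin; zero; suc)
open import Data.Fin.Properties using (_≟_; any?; injective⇒≤; 0≢1+n; suc-injective)
open import Data.Fin.Subset using (Subset; Empty; _∈_; _∉_; _⊆_; _∩_; _∪_; _─_; ⁅_⁆; ∣_∣; _-_; ⊤; inside; outside)
open import Data.Fin.Subset.Properties
  using (∈⊤; x∈⁅x⁆; x∈⁅y⁆⇒x≡y; ∣p∣≤n; x∈p∪q⁺; x∈p∪q⁻; x∈p∧x∉q⇒x∈p─q; x∈p∧x≢y⇒x∈p-y;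
         x∈p⇒∣p-x∣<∣p∣; p─q⊆p)
open import Data.List.Base using (List; []; _∷_)
import Data.List.Membership.DecPropositional as DecMembership
import Data.List.Membership.Propositional as List
open import Data.List.Relation.Unary.All as All using ()
open import Data.List.Relation.Unary.AllPairs.Core using ([]; _∷_)
open import Data.List.Relation.Unary.Any using (here; there)
open import Data.List.Relation.Unary.Unique.Propositional using (Unique)
open import Data.Nat.Base using (ℕ; zero; suc; _≤_; _∸_; z≤n; s≤s)
import Data.Nat.Properties as ℕ
open import Data.Product using (_×_; _,_; ∃; ∃-syntax; proj₁; proj₂)
open import Data.Sum.Base as Sum using (_⊎_; inj₁; inj₂; [_,_]′)
open import Data.Vec.Base using (_∷_; here; there)
open import Data.Vec.Functional as Vector using (Vector)
open import Function.Base using (flip; _∘_; id)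
open import Function.Definitions using (Injective)
open import Level using (0ℓ)
open import Relation.Binary.Construct.Closure.ReflexiveTransitive
  using (Star; ε; _◅_; _◅◅_; reverse)
open import Relation.Binary.Core using (Rel)
open import Relation.Binary.PropositionalEquality.Core
  using (_≡_; _≢_; refl; sym; cong; subst)
open import Relation.Binary.Rewriting using (Deterministic)
open import Relation.Nullary.Decidable.Core using (yes; no)
open import Relation.Nullary.Negation.Core using (¬_; contradiction)
open import Relation.Unary as Pred using (Pred; _≐_; ｛_｝)

x∈p─q⇒x∉q : ∀ {n x} (p q : Subset n) → x ∈ p ─ q → x ∉ q
x∈p─q⇒x∉q (_ ∷ p) (outside ∷ q) (there x∈p─q) (there x∈q) = x∈p─q⇒x∉q p q x∈p─q x∈q
x∈p─q⇒x∉q (_ ∷ p) (inside ∷ q)  (there x∈p─q) (there x∈q) = x∈p─q⇒x∉q p q x∈p─q x∈q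

Terminal : {A : Set} → Rel A 0ℓ → Pred A 0ℓ
Terminal R x = ∀ {y} → ¬ R x y

-- Sequences of steps

module _ {A : Set} {R : Rel A 0ℓ} where

  -- Kept general in `R`, since it serves walks of `G`, orbits of a matching and alternating orbits
  -- alike.
  vertices : ∀ {u v} → Star R u v → List A
  vertices {u} ε       = u ∷ []
  vertices {u} (_ ◅ w) = u ∷ vertices w

  source∈vertices : ∀ {u v} (w : Star R u v) → u List.∈ vertices w
  source∈vertices ε       = here refl
  source∈vertices (_ ◅ w) = here refl

  target∈vertices : ∀ {u v} (w : Star R u v) → v List.∈ vertices w
  target∈vertices ε       = here refl
  target∈vertices (_ ◅ w) = there (target∈vertices w)

  prefix : ∀ {u v x} (w : Star R u v) → x List.∈ vertices w → Star R u x
  prefix ε       (here refl) = ε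
  prefix (_ ◅ _) (here refl) = ε
  prefix (e ◅ w) (there x∈w) = e ◅ prefix w x∈w

  suffix : ∀ {u v x} (w : Star R u v) → x List.∈ vertices w → Star R x v
  suffix ε       (here refl) = ε
  suffix (e ◅ w) (here refl) = e ◅ w
  suffix (_ ◅ w) (there x∈w) = suffix w x∈w

  data Consecutive : ∀ {u v} → Star R u v → Rel A 0ℓ where
    here  : ∀ {u x v} {e : R u x} {w : Star R x v} → Consecutive (e ◅ w) u x
    there : ∀ {u x v y z} {e : R u x} {w : Star R x v} →
            Consecutive w y z → Consecutive (e ◅ w) y z

  consecutive⇒R : ∀ {u v} {w : Star R u v} {y z} → Consecutive w y z → R y z
  consecutive⇒R {w = e ◅ _} here      = e
  consecutive⇒R             (there c) = consecutive⇒R c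

  consecutive-∈ˡ : ∀ {u v} {w : Star R u v} {y z} → Consecutive w y z → y List.∈ vertices w
  consecutive-∈ˡ here      = here refl
  consecutive-∈ˡ (there c) = there (consecutive-∈ˡ c)

  consecutive-∈ʳ : ∀ {u v} {w : Star R u v} {y z} → Consecutive w y z → z List.∈ vertices w
  consecutive-∈ʳ {w = _ ◅ w} here      = there (source∈vertices w)
  consecutive-∈ʳ             (there c) = there (consecutive-∈ʳ c)

  target⊎successor : ∀ {u v x} (w : Star R u v) → x List.∈ vertices w →
                     v ≡ x ⊎ ∃[ y ] Consecutive w x y
  target⊎successor ε       (here refl) = inj₁ refl
  target⊎successor (_ ◅ _) (here refl) = inj₂ (_ , here)
  target⊎successor (_ ◅ w) (there x∈w) with target⊎successor w x∈w
  ... | inj₁ v≡x     = inj₁ v≡x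
  ... | inj₂ (y , c) = inj₂ (y , there c)

  source⊎predecessor : ∀ {u v x} (w : Star R u v) → x List.∈ vertices w →
                       u ≡ x ⊎ ∃[ y ] Consecutive w y x
  source⊎predecessor ε       (here refl) = inj₁ refl
  source⊎predecessor (_ ◅ _) (here refl) = inj₁ refl
  source⊎predecessor (_ ◅ w) (there x∈w) with source⊎predecessor w x∈w
  ... | inj₁ refl    = inj₂ (_ , here)
  ... | inj₂ (y , c) = inj₂ (y , there c)

  consecutive-≢source : ∀ {u v} {w : Star R u v} → Unique (vertices w) →
                        ∀ {y z} → Consecutive w y z → u ≢ z
  consecutive-≢source {w = _ ◅ w} (u∉ ∷ _) here      refl =
    All.lookup u∉ (source∈vertices w) refl
  consecutive-≢source {w = _ ◅ _} (u∉ ∷ _) (there c) refl =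
    All.lookup u∉ (consecutive-∈ʳ c) refl

  consecutive-≢target : ∀ {u v} {w : Star R u v} → Unique (vertices w) →
                        ∀ {y z} → Consecutive w y z → v ≢ y
  consecutive-≢target {w = _ ◅ w} (u∉ ∷ _) here      refl = All.lookup u∉ (target∈vertices w) refl
  consecutive-≢target {w = _ ◅ _} (_ ∷ un) (there c) v≡y  = consecutive-≢target un c v≡y

  consecutive-deterministic : ∀ {u v} {w : Star R u v} → Unique (vertices w) →
                              Deterministic _≡_ (Consecutive w)
  consecutive-deterministic _        here      here      = refl
  consecutive-deterministic {w = _ ◅ _} (u∉ ∷ _) here      (there d) =
    contradiction refl (All.lookup u∉ (consecutive-∈ˡ d))
  consecutive-deterministic {w = _ ◅ _} (u∉ ∷ _) (there c) here      =
    contradiction refl (All.lookup u∉ (consecutive-∈ˡ c))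
  consecutive-deterministic {w = _ ◅ _} (_ ∷ un) (there c) (there d) = consecutive-deterministic un c d

  consecutive-codeterministic : ∀ {u v} {w : Star R u v} → Unique (vertices w) →
                                Deterministic _≡_ (flip (Consecutive w))
  consecutive-codeterministic _        here      here      = refl
  consecutive-codeterministic {w = _ ◅ _} (_ ∷ un) here      (there d) =
    contradiction refl (consecutive-≢source un d)
  consecutive-codeterministic {w = _ ◅ _} (_ ∷ un) (there c) here      =
    contradiction refl (consecutive-≢source un c)
  consecutive-codeterministic {w = _ ◅ _} (_ ∷ un) (there c) (there d) = consecutive-codeterministic un c d

-- Deterministic relations

module _ {A : Set} {R : Rel A 0ℓ} (det : Deterministic _≡_ R) where

  terminal-unique : ∀ {x v v′} → Star R x v → Terminal R v → Star R x v′ → Terminal R v′ → v ≡ v′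
  terminal-unique ε       v-term ε         v′-term = refl
  terminal-unique ε       v-term (e ◅ _)   v′-term = contradiction e v-term
  terminal-unique (e ◅ _) v-term ε         v′-term = contradiction e v′-term
  terminal-unique (e ◅ w) v-term (e′ ◅ w′) v′-term with refl ← det e e′ =
    terminal-unique w v-term w′ v′-term

  -- The cycle is rotated along the sequence that leads to the terminal element.
  terminal⇒acyclic : ∀ {x y v} → Star R x v → Terminal R v → R x y → ¬ Star R y x
  terminal⇒acyclic ε        v-term e c = v-term e
  terminal⇒acyclic (e′ ◅ w) v-term e c with refl ← det e e′ | c
  ... | ε      = terminal⇒acyclic w v-term e ε
  ... | d ◅ c′ = terminal⇒acyclic w v-term d (c′ ◅◅ (e ◅ ε))

  -- A repeated vertex would lie on a cycle, which `terminal⇒acyclic` forbids on the way to a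
  -- terminal element.
  terminal⇒unique : ∀ {u v} (w : Star R u v) → Terminal R v → Unique (vertices w)
  terminal⇒unique ε       _      = All.[] ∷ []
  terminal⇒unique (e ◅ w) v-term =
    All.tabulate (λ { x∈w refl → terminal⇒acyclic (e ◅ w) v-term e (prefix w x∈w) })
    ∷ terminal⇒unique w v-term

  successor∈vertices : ∀ {u v x y} (w : Star R u v) → Terminal R v →
                       x List.∈ vertices w → R x y → y List.∈ vertices w
  successor∈vertices ε       v-term (here refl) e  = contradiction e v-term
  successor∈vertices (e ◅ w) v-term (here refl) e′ with refl ← det e e′ = there (source∈vertices w)
  successor∈vertices (_ ◅ w) v-term (there x∈w) e  = there (successor∈vertices w v-term x∈w e)

-- Reversal turns this into `terminal-unique`. It separates both the paths read off a matching and
-- the ends of the alternating orbits.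
initial-unique : {A : Set} {R : Rel A 0ℓ} → Deterministic _≡_ (flip R) → ∀ {u u′ v} →
                 Star R u v → Terminal (flip R) u → Star R u′ v → Terminal (flip R) u′ → u ≡ u′
initial-unique codet w u-init w′ u′-init =
  terminal-unique codet (reverse id w) u-init (reverse id w′) u′-init

-- Descent in a finite set

module _ {n : ℕ} {R : Rel (Fin n) 0ℓ} {P : Pred (Fin n) 0ℓ}
         (codet : Deterministic _≡_ (flip R)) (step : ∀ v → P v ⊎ ∃[ w ] R v w) where

  private
    -- The complement of U is the set of elements visited before v.
    descend : ∀ m (U : Subset n) → ∣ U ∣ ≤ m → ∀ {v} → v ∈ U →
              (∀ {x y} → x ∈ U → R x y → y ∈ U × v ≢ y) → ∃[ r ] (Star R v r × P r)
    descend m U ∣U∣≤m {v} v∈U closed with step v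
    ... | inj₁ Pv = v , ε , Pv
    descend zero U ∣U∣≤m v∈U closed | inj₂ _ =
      contradiction (ℕ.≤-trans (x∈p⇒∣p-x∣<∣p∣ v∈U) ∣U∣≤m) λ ()
    descend (suc m) U ∣U∣≤m {v} v∈U closed | inj₂ (w , e)
      with w∈U , v≢w ← closed v∈U e =
      let r , p , Pr = descend m (U - v)
            (ℕ.≤-pred (ℕ.≤-trans (x∈p⇒∣p-x∣<∣p∣ v∈U) ∣U∣≤m))
            (x∈p∧x≢y⇒x∈p-y w∈U (v≢w ∘ sym)) closed′
      in r , e ◅ p , Pr
      where
      closed′ : ∀ {x y} → x ∈ U - v → R x y → y ∈ U - v × w ≢ y
      closed′ x∈U-v d with y∈U , v≢y ← closed (p─q⊆p U ⁅ v ⁆ x∈U-v) d =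
        x∈p∧x≢y⇒x∈p-y y∈U (v≢y ∘ sym) ,
        -- If `y` were `w`, codeterminism would make `x` equal to `v`, which has been removed.
        λ { refl → x∈p─q⇒x∉q U ⁅ v ⁆ x∈U-v (subst (_∈ ⁅ v ⁆) (codet e d) (x∈⁅x⁆ v)) }

  -- Nothing leads back to the initial `v`, and codeterminism forbids entering a later vertex from
  -- two places. In a finite set the steps therefore run out, and they can stop only in `P`.
  descends : ∀ v → Terminal (flip R) v → ∃[ r ] (Star R v r × P r)
  descends v v-init = descend n ⊤ (∣p∣≤n ⊤) ∈⊤ λ _ e → ∈⊤ , λ { refl → v-init e }

-- Matchings

Range : {A B : Set} → (A → B) → Pred B 0ℓ
Range f y = ∃[ x ] f x ≡ y

∷-injective : ∀ {A : Set} {m} {f : Vector A m} {x} → Injective _≡_ _≡_ f → ¬ Range f x →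
              Injective _≡_ _≡_ (x Vector.∷ f)
∷-injective inj x∉f {zero}  {zero}  _  = refl
∷-injective inj x∉f {zero}  {suc j} eq = contradiction (j , sym eq) x∉f
∷-injective inj x∉f {suc i} {zero}  eq = contradiction (i , eq) x∉f
∷-injective inj x∉f {suc i} {suc j} eq = cong suc (inj eq)

choose : ∀ {m} {P Q : Pred (Fin m) 0ℓ} → (∀ i → P i ⊎ Q i) → (∀ i → P i) ⊎ ∃ Q
choose {zero}  P⊎Q = inj₁ λ ()
choose {suc m} P⊎Q with P⊎Q zero | choose (P⊎Q ∘ suc)
... | inj₂ q | _            = inj₂ (zero , q)
... | inj₁ _ | inj₂ (i , q) = inj₂ (suc i , q)
... | inj₁ p | inj₁ ps      = inj₁ λ { zero → p ; (suc i) → ps i }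

module _ {n : ℕ} (G : Graph n) where
  open Graph G using (Adj)
  open Path using (source; target; walk; unique)
  open DecMembership (_≟_ {n}) using () renaming (_∈?_ to _∈ₗ?_)

  walkVertices≡vertices : ∀ {u v} (w : Walk G u v) → walkVertices G w ≡ vertices w
  walkVertices≡vertices ε       = refl
  walkVertices≡vertices (_ ◅ w) = cong (_ ∷_) (walkVertices≡vertices w)

  -- A matching between a left and a right copy of the vertex set, where `Edge v w` joins `v` on the
  -- left to `w` on the right. The unmatched vertices are `B` on the left and `A` on the right. The
  -- fields `into` and `out` supply witnesses, so that orbits can be followed without deciding
  -- `Edge`.
  record Matching (A B : Pred (Fin n) 0ℓ) : Set₁ where
    field
      Edge            : Rel (Fin n) 0ℓ
      deterministic   : Deterministic _≡_ Edge
      codeterministic : Deterministic _≡_ (flip Edge)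
      edge⇒adj        : ∀ {v w} → Edge v w → v ≡ w ⊎ Adj v w
      initial         : ∀ {v} → A v → Terminal (flip Edge) v
      terminal        : ∀ {v} → B v → Terminal Edge v
      into            : ∀ w → A w ⊎ ∃[ v ] Edge v w
      out             : ∀ v → B v ⊎ ∃[ w ] Edge v w

  -- From linkages to matchings

  module _ {m : ℕ} {X Y : Subset n} (L : Linked G m X Y) where
    open Linked L

    private
      path-vertices : Fin m → List (Fin n)
      path-vertices i = vertices (walk (path i))

      ∈walkVertices : ∀ {x} i → x List.∈ path-vertices i → x List.∈ Path.vertices (path i)
      ∈walkVertices i = subst (_ List.∈_) (sym (walkVertices≡vertices (walk (path i))))

      unique′ : ∀ i → Unique (path-vertices i)
      unique′ i = subst Unique (walkVertices≡vertices (walk (path i))) (unique (path i))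

      same-path : ∀ {i j x} → x List.∈ path-vertices i → x List.∈ path-vertices j → i ≡ j
      same-path {i} {j} x∈i x∈j with i ≟ j
      ... | yes i≡j = i≡j
      ... | no  i≢j = contradiction (∈walkVertices j x∈j) (disjoint i≢j (∈walkVertices i x∈i))

      OnNoPath : Pred (Fin n) 0ℓ
      OnNoPath v = ∀ i → ¬ v List.∈ path-vertices i

      onPath? : ∀ v → (∃[ i ] v List.∈ path-vertices i) ⊎ OnNoPath v
      onPath? v with any? (λ i → v ∈ₗ? path-vertices i)
      ... | yes on = inj₁ on
      ... | no off = inj₂ λ i v∈i → off (i , v∈i)

      Next : Rel (Fin n) 0ℓ
      Next v w = (∃[ i ] Consecutive (walk (path i)) v w) ⊎ (v ≡ w × OnNoPath v)

    linked-source-injective : Injective _≡_ _≡_ (source ∘ path)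
    linked-source-injective {i} {j} eq = same-path (source∈vertices (walk (path i)))
      (subst (List._∈ path-vertices j) (sym eq) (source∈vertices (walk (path j))))

    linked-target-injective : Injective _≡_ _≡_ (target ∘ path)
    linked-target-injective {i} {j} eq = same-path (target∈vertices (walk (path i)))
      (subst (List._∈ path-vertices j) (sym eq) (target∈vertices (walk (path j))))

    -- On disjoint simple paths successors and predecessors are unique, and the loops of `Next` stay
    -- off the paths. Ranges appear here instead of `X` and `Y` because these may contain vertices
    -- on no path, which are matched by loops.
    linked⇒matching : Matching (Range (source ∘ path)) (Range (target ∘ path))
    linked⇒matching = record
      { Edge            = Next
      ; deterministic   = det
      ; codeterministic = codet
      ; edge⇒adj        = λ { (inj₁ (i , c)) → inj₂ (consecutive⇒R c) ; (inj₂ (v≡w , _)) → inj₁ v≡w }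
      ; initial         = init
      ; terminal        = term
      ; into            = in′
      ; out             = out′
      }
      where
      det : Deterministic _≡_ Next
      det (inj₁ (i , c)) (inj₁ (j , d))
        with refl ← same-path (consecutive-∈ˡ c) (consecutive-∈ˡ d) =
        consecutive-deterministic (unique′ i) c d
      det (inj₁ (i , c))       (inj₂ (_ , off))     = contradiction (consecutive-∈ˡ c) (off i)
      det (inj₂ (_ , off))     (inj₁ (i , c))       = contradiction (consecutive-∈ˡ c) (off i)
      det (inj₂ (refl , _))    (inj₂ (refl , _))    = refl

      codet : Deterministic _≡_ (flip Next)
      codet (inj₁ (i , c)) (inj₁ (j , d))
        with refl ← same-path (consecutive-∈ʳ c) (consecutive-∈ʳ d) =
        consecutive-codeterministic (unique′ i) c d
      codet (inj₁ (i , c))      (inj₂ (refl , off)) = contradiction (consecutive-∈ʳ c) (off i)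
      codet (inj₂ (refl , off)) (inj₁ (i , c))      = contradiction (consecutive-∈ʳ c) (off i)
      codet (inj₂ (refl , _))   (inj₂ (refl , _))   = refl

      init : ∀ {v} → Range (source ∘ path) v → Terminal (flip Next) v
      init (i , refl) (inj₁ (j , c))
        with refl ← same-path (source∈vertices (walk (path i))) (consecutive-∈ʳ c) =
        consecutive-≢source (unique′ i) c refl
      init (i , refl) (inj₂ (refl , off)) = off i (source∈vertices (walk (path i)))

      term : ∀ {v} → Range (target ∘ path) v → Terminal Next v
      term (i , refl) (inj₁ (j , c))
        with refl ← same-path (target∈vertices (walk (path i))) (consecutive-∈ˡ c) =
        consecutive-≢target (unique′ i) c refl
      term (i , refl) (inj₂ (_ , off)) = off i (target∈vertices (walk (path i)))

      in′ : ∀ w → Range (source ∘ path) w ⊎ ∃[ v ] Next v w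
      in′ w with onPath? w
      ... | inj₂ off = inj₂ (w , inj₂ (refl , off))
      ... | inj₁ (i , w∈i) with source⊎predecessor (walk (path i)) w∈i
      ...   | inj₁ s≡w     = inj₁ (i , s≡w)
      ...   | inj₂ (v , c) = inj₂ (v , inj₁ (i , c))

      out′ : ∀ v → Range (target ∘ path) v ⊎ ∃[ w ] Next v w
      out′ v with onPath? v
      ... | inj₂ off = inj₂ (v , inj₂ (refl , off))
      ... | inj₁ (i , v∈i) with target⊎successor (walk (path i)) v∈i
      ...   | inj₁ t≡v     = inj₁ (i , t≡v)
      ...   | inj₂ (w , c) = inj₂ (w , inj₁ (i , c))

  matching-resp-≐ : ∀ {A A′ B B′} → A ≐ A′ → B ≐ B′ → Matching A B → Matching A′ B′
  matching-resp-≐ (A⊆A′ , A′⊆A) (B⊆B′ , B′⊆B) M = record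
    { Edge            = Edge
    ; deterministic   = deterministic
    ; codeterministic = codeterministic
    ; edge⇒adj        = edge⇒adj
    ; initial         = initial ∘ A′⊆A
    ; terminal        = terminal ∘ B′⊆B
    ; into            = λ w → Sum.map₁ A⊆A′ (into w)
    ; out             = λ v → Sum.map₁ B⊆B′ (out v)
    }
    where open Matching M

  -- From matchings to linkages

  module _ {X Y : Subset n} (M : Matching (_∈ X) (_∈ Y)) where
    open Matching M

    private
      -- Fixed points of M do not occur on the way to a terminal vertex.
      toWalk : ∀ {u v} → Star Edge u v → Terminal Edge v → Walk G u v
      toWalk ε       _ = ε
      toWalk (e ◅ w) t with edge⇒adj e
      ... | inj₁ refl = contradiction ε (terminal⇒acyclic deterministic (e ◅ w) t e)
      ... | inj₂ adj  = adj ◅ toWalk w t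

      vertices-toWalk : ∀ {u v} (w : Star Edge u v) (t : Terminal Edge v) →
                        walkVertices G (toWalk w t) ≡ vertices w
      vertices-toWalk ε       _ = refl
      vertices-toWalk (e ◅ w) t with edge⇒adj e
      ... | inj₁ refl = contradiction ε (terminal⇒acyclic deterministic (e ◅ w) t e)
      ... | inj₂ _    = cong (_ ∷_) (vertices-toWalk w t)

    -- The paths are the orbits of the `α i`, which reach `Y` by `descends`. Two orbits that meet
    -- can be traced back to the same start. Members of `X` have no predecessor and members of `Y`
    -- no successor, so they occur on an orbit only at its two ends.
    matching⇒linked : ∀ {m} (α : Fin m → Fin n) → Injective _≡_ _≡_ α → (∀ i → α i ∈ X) →
                      Linked G m X Y
    matching⇒linked {m} α α-injective α∈X = record
      { path     = λ i → record
          { walk   = toWalk (orbit i) (end-terminal i)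
          ; unique = subst Unique (sym (orbit-vertices i))
                       (terminal⇒unique deterministic (orbit i) (end-terminal i))
          }
      ; source∈  = α∈X
      ; target∈  = end∈Y
      ; disjoint = λ i≢j v∈i v∈j → i≢j (meet⇒≡ (from-orbit _ v∈i) (from-orbit _ v∈j))
      ; once₁    = λ i → α i , (to-orbit i (source∈vertices (orbit i)) , α∈X i) ,
                     λ (v∈i , v∈X) → source-only i (from-orbit i v∈i) v∈X
      ; once₂    = λ i → end i , (to-orbit i (target∈vertices (orbit i)) , end∈Y i) ,
                     λ (v∈i , v∈Y) → target-only i (from-orbit i v∈i) v∈Y
      }
      where
      descent : ∀ i → ∃[ r ] (Star Edge (α i) r × r ∈ Y)
      descent i = descends codeterministic out (α i) (initial (α∈X i))

      end : Fin m → Fin n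
      end i = proj₁ (descent i)

      orbit : ∀ i → Star Edge (α i) (end i)
      orbit i = proj₁ (proj₂ (descent i))

      end∈Y : ∀ i → end i ∈ Y
      end∈Y i = proj₂ (proj₂ (descent i))

      end-terminal : ∀ i → Terminal Edge (end i)
      end-terminal i = terminal (end∈Y i)

      orbit-vertices : ∀ i → walkVertices G (toWalk (orbit i) (end-terminal i)) ≡ vertices (orbit i)
      orbit-vertices i = vertices-toWalk (orbit i) (end-terminal i)

      from-orbit : ∀ i {v} → v List.∈ walkVertices G (toWalk (orbit i) (end-terminal i)) →
                   v List.∈ vertices (orbit i)
      from-orbit i = subst (_ List.∈_) (orbit-vertices i)

      to-orbit : ∀ i {v} → v List.∈ vertices (orbit i) →
                 v List.∈ walkVertices G (toWalk (orbit i) (end-terminal i))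
      to-orbit i = subst (_ List.∈_) (sym (orbit-vertices i))

      meet⇒≡ : ∀ {i j v} → v List.∈ vertices (orbit i) → v List.∈ vertices (orbit j) → i ≡ j
      meet⇒≡ {i} {j} v∈i v∈j = α-injective (initial-unique codeterministic
        (prefix (orbit i) v∈i) (initial (α∈X i)) (prefix (orbit j) v∈j) (initial (α∈X j)))

      source-only : ∀ i {v} → v List.∈ vertices (orbit i) → v ∈ X → α i ≡ v
      source-only i v∈i v∈X with source⊎predecessor (orbit i) v∈i
      ... | inj₁ α≡v     = α≡v
      ... | inj₂ (_ , c) = contradiction (consecutive⇒R c) (initial v∈X)

      target-only : ∀ i {v} → v List.∈ vertices (orbit i) → v ∈ Y → end i ≡ v
      target-only i v∈i v∈Y with target⊎successor (orbit i) v∈i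
      ... | inj₁ end≡v   = end≡v
      ... | inj₂ (_ , c) = contradiction (consecutive⇒R c) (terminal v∈Y)

  -- Alternating orbits of two matchings

  module _ {A B A′ B′ : Pred (Fin n) 0ℓ} (M : Matching A B) (N : Matching A′ B′) where
    private
      module M = Matching M
      module N = Matching N

    -- The composite `N ∘ M⁻¹`. Its orbits are the alternating paths of the two matchings, recorded
    -- by their vertices in the right copy.
    Alternate : Rel (Fin n) 0ℓ
    Alternate r r′ = ∃[ v ] (M.Edge v r × N.Edge v r′)

    alternate-deterministic : Deterministic _≡_ Alternate
    alternate-deterministic (_ , e , f) (_ , e′ , f′) with refl ← M.codeterministic e e′ =
      N.deterministic f f′

    alternate-codeterministic : Deterministic _≡_ (flip Alternate)
    alternate-codeterministic (_ , e , f) (_ , e′ , f′) with refl ← N.codeterministic f f′ =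
      M.deterministic e e′

    alternate-initial : ∀ {a} → A′ a → Terminal (flip Alternate) a
    alternate-initial A′a (_ , _ , f) = N.initial A′a f

    -- Here the alternating path stops at a `b` that `N` leaves unmatched. If it also started at a
    -- vertex of `A′`, both its end edges are in `M`: switching then costs `M` one edge, which means
    -- one more path in the linkage.
    Augmenting : Pred (Fin n) 0ℓ
    Augmenting r = ∃[ b ] (M.Edge b r × B′ b)

    alternate-step : ∀ r → (A r ⊎ Augmenting r) ⊎ ∃[ r′ ] Alternate r r′
    alternate-step r with M.into r
    ... | inj₁ Ar = inj₁ (inj₁ Ar)
    ... | inj₂ (v , e) with N.out v
    ...   | inj₁ B′v      = inj₁ (inj₂ (v , e , B′v))
    ...   | inj₂ (r′ , f) = inj₂ (r′ , v , e , f)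

    end-terminal : ∀ {r} → A r ⊎ Augmenting r → Terminal Alternate r
    end-terminal (inj₁ Ar)            (_ , e , _) = M.initial Ar e
    end-terminal (inj₂ (_ , e , B′b)) (_ , e′ , f) with refl ← M.codeterministic e e′ =
      N.terminal B′b f

    alternate-end : ∀ {a} → A′ a → (∃[ r ] (Star Alternate a r × A r)) ⊎
                                   (∃[ r ] (Star Alternate a r × Augmenting r))
    alternate-end A′a
      with descends alternate-codeterministic alternate-step _ (alternate-initial A′a)
    ... | r , orbit , inj₁ Ar  = inj₁ (r , orbit , Ar)
    ... | r , orbit , inj₂ aug = inj₂ (r , orbit , aug)

    module _ {a b r : Fin n} (orbit : Star Alternate a r) (A′a : A′ a)
             (last : M.Edge b r) (B′b : B′ b) where
      private
        InOrbit : Pred (Fin n) 0ℓ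
        InOrbit x = x List.∈ vertices orbit

        inOrbit? : ∀ x → InOrbit x ⊎ ¬ InOrbit x
        inOrbit? x with x ∈ₗ? vertices orbit
        ... | yes x∈o = inj₁ x∈o
        ... | no  x∉o = inj₂ x∉o

        orbit-M : ∀ {x} → InOrbit x → r ≡ x ⊎ ∃[ y ] Alternate x y
        orbit-M x∈o with target⊎successor orbit x∈o
        ... | inj₁ r≡x     = inj₁ r≡x
        ... | inj₂ (y , c) = inj₂ (y , consecutive⇒R c)

        -- Each vertex of the orbit has an `M`-predecessor: `b` for the last one, the middle vertex
        -- of an alternating step for the others.
        orbit-M-out : ∀ {x} → InOrbit x → ¬ A x
        orbit-M-out x∈o Ax with orbit-M x∈o
        ... | inj₁ refl            = M.initial Ax last
        ... | inj₂ (_ , _ , e , _) = M.initial Ax e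

        -- The start `a` has no `N`-predecessor. Any other vertex of the orbit is entered by an
        -- alternating step, whose middle vertex must be `v` and is matched by `M` to the preceding
        -- vertex of the orbit.
        orbit-N : ∀ {v y} → InOrbit y → N.Edge v y → ∃[ x ] (InOrbit x × M.Edge v x)
        orbit-N y∈o f with source⊎predecessor orbit y∈o
        ... | inj₁ refl    = contradiction f (N.initial A′a)
        ... | inj₂ (x , c) with consecutive⇒R c
        ...   | v , e , f′ with refl ← N.codeterministic f f′ = x , consecutive-∈ˡ c , e

        -- The symmetric difference of `M` with the alternating path. Deciding by the right end `w`
        -- makes codeterminism immediate and leaves determinism to `orbit-N`.
        Switched : Rel (Fin n) 0ℓ
        Switched v w = (InOrbit w × N.Edge v w) ⊎ (¬ InOrbit w × M.Edge v w)

      augment-fresh : ¬ A a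
      augment-fresh = orbit-M-out (source∈vertices orbit)

      -- In the orbit only `a` lacks an `N`-predecessor, so it is the one new unmatched vertex on
      -- the right. Among the `M`-preimages of the orbit only `b` lacks an `N`-successor, so it is
      -- the one on the left.
      augment : Matching (A Pred.∪ ｛ a ｝) (B Pred.∪ ｛ b ｝)
      augment = record
        { Edge            = Switched
        ; deterministic   = det
        ; codeterministic = codet
        ; edge⇒adj        = [ N.edge⇒adj ∘ proj₂ , M.edge⇒adj ∘ proj₂ ]′
        ; initial         = init
        ; terminal        = term
        ; into            = in′
        ; out             = out′
        }
        where
        det : Deterministic _≡_ Switched
        det (inj₁ (_ , f)) (inj₁ (_ , f′)) = N.deterministic f f′
        det (inj₂ (_ , e)) (inj₂ (_ , e′)) = M.deterministic e e′
        -- An `N`-edge into the orbit starts at a vertex whose `M`-edge also ends in the orbit, so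
        -- that `M`-edge was discarded.
        det (inj₁ (w∈o , f)) (inj₂ (w′∉o , e))
          with x , x∈o , e′ ← orbit-N w∈o f
          with refl ← M.deterministic e e′ = contradiction x∈o w′∉o
        det (inj₂ (w′∉o , e)) (inj₁ (w∈o , f))
          with x , x∈o , e′ ← orbit-N w∈o f
          with refl ← M.deterministic e e′ = contradiction x∈o w′∉o

        codet : Deterministic _≡_ (flip Switched)
        codet (inj₁ (_ , f))   (inj₁ (_ , f′))  = N.codeterministic f f′
        codet (inj₂ (_ , e))   (inj₂ (_ , e′))  = M.codeterministic e e′
        codet (inj₁ (w∈o , _)) (inj₂ (w∉o , _)) = contradiction w∈o w∉o
        codet (inj₂ (w∉o , _)) (inj₁ (w∈o , _)) = contradiction w∈o w∉o

        init : ∀ {v} → (A Pred.∪ ｛ a ｝) v → Terminal (flip Switched) v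
        init (inj₁ Av)   (inj₁ (v∈o , _)) = orbit-M-out v∈o Av
        init (inj₁ Av)   (inj₂ (_ , e))   = M.initial Av e
        init (inj₂ refl) (inj₁ (_ , f))   = N.initial A′a f
        init (inj₂ refl) (inj₂ (a∉o , _)) = a∉o (source∈vertices orbit)

        term : ∀ {v} → (B Pred.∪ ｛ b ｝) v → Terminal Switched v
        term (inj₁ Bv)   (inj₁ (w∈o , f)) with _ , _ , e ← orbit-N w∈o f = M.terminal Bv e
        term (inj₁ Bv)   (inj₂ (_ , e))   = M.terminal Bv e
        term (inj₂ refl) (inj₁ (_ , f))   = N.terminal B′b f
        -- The only `M`-edge at `b` is `last`, and it ends in the orbit.
        term (inj₂ refl) (inj₂ (w∉o , e)) with refl ← M.deterministic e last =
          w∉o (target∈vertices orbit)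

        in′ : ∀ w → (A Pred.∪ ｛ a ｝) w ⊎ ∃[ v ] Switched v w
        in′ w with inOrbit? w
        ... | inj₂ w∉o with M.into w
        ...   | inj₁ Aw      = inj₁ (inj₁ Aw)
        ...   | inj₂ (v , e) = inj₂ (v , inj₂ (w∉o , e))
        in′ w | inj₁ w∈o with source⊎predecessor orbit w∈o
        ...   | inj₁ a≡w     = inj₁ (inj₂ a≡w)
        ...   | inj₂ (_ , c) with v , _ , f ← consecutive⇒R c = inj₂ (v , inj₁ (w∈o , f))

        out′ : ∀ v → (B Pred.∪ ｛ b ｝) v ⊎ ∃[ w ] Switched v w
        out′ v with M.out v
        ... | inj₁ Bv = inj₁ (inj₁ Bv)
        ... | inj₂ (x , e) with inOrbit? x
        ...   | inj₂ x∉o = inj₂ (x , inj₂ (x∉o , e))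
        ...   | inj₁ x∈o with orbit-M x∈o
        -- The orbit ends at `r`, whose only `M`-predecessor is `b`.
        ...     | inj₁ refl = inj₁ (inj₂ (M.codeterministic last e))
        -- The edges `e` and `f` at `v` form an alternating step from `x`, so `y` is again in the
        -- orbit.
        ...     | inj₂ (y , _ , e′ , f) with refl ← M.codeterministic e e′ =
          inj₂ (y , inj₁ (successor∈vertices alternate-deterministic orbit
                            (end-terminal (inj₂ (b , last , B′b))) x∈o (v , e , f) , f))

  -- If no orbit from `Range α′` were augmenting, all of them would end in `Range α`, and sending
  -- each start to the index of its end would inject `Fin (suc m)` into `Fin m`. An augmenting `b`
  -- is not in `B` because `M` has an edge leaving it.
  exchange : ∀ {m} {α : Fin m → Fin n} {α′ : Fin (suc m) → Fin n} {B B′ : Pred (Fin n) 0ℓ} →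
             Injective _≡_ _≡_ α′ → Matching (Range α) B → Matching (Range α′) B′ →
             ∃[ a ] ∃[ b ] ((Range α′ a × ¬ Range α a) × (B′ b × ¬ B b) ×
               Matching (Range α Pred.∪ ｛ a ｝) (B Pred.∪ ｛ b ｝))
  exchange {m} {α} {α′} α′-injective M N with choose (λ i → alternate-end M N (i , refl))
  ... | inj₂ (i , r , orbit , b , last , B′b) =
    α′ i , b , ((i , refl) , augment-fresh M N orbit (i , refl) last B′b) ,
    (B′b , λ Bb → Matching.terminal M Bb last) , augment M N orbit (i , refl) last B′b
  ... | inj₁ ends = contradiction (injective⇒≤ ends-injective) ℕ.1+n≰n
    where
    -- The function gives the index under `α` of the end of the orbit of `α′ i`; equal indices mean
    -- equal ends, which trace back to equal starts.
    ends-injective : Injective _≡_ _≡_ (λ i → proj₁ (proj₂ (proj₂ (ends i))))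
    ends-injective {i} {j} eq with ends i | ends j
    ... | _ , orbit , _ , refl | _ , orbit′ , _ , refl with refl ← eq =
      α′-injective (initial-unique (alternate-codeterministic M N)
        orbit (alternate-initial M N (i , refl)) orbit′ (alternate-initial M N (j , refl)))

-- Counting injections into a subset

injective⇒≤∣∣ : ∀ {m n} {f : Fin m → Fin n} (p : Subset n) →
                Injective _≡_ _≡_ f → (∀ i → f i ∈ p) → m ≤ ∣ p ∣
injective⇒≤∣∣ {zero}          p inj f∈p = z≤n
injective⇒≤∣∣ {suc m} {f = f} p inj f∈p = ℕ.≤-trans
  (s≤s (injective⇒≤∣∣ (p - f zero) (suc-injective ∘ inj)
    λ i → x∈p∧x≢y⇒x∈p-y (f∈p (suc i)) (0≢1+n ∘ sym ∘ inj)))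
  (x∈p⇒∣p-x∣<∣p∣ (f∈p zero))

-- An element of `p` missed by `f` could be added as a further value, giving an injection of `suc m`
-- indices into `p`. This shows that a linkage of `T₁` and `T₂` uses every vertex of both sets.
injective⇒Range≐ : ∀ {m n} {f : Fin m → Fin n} (p : Subset n) →
                   Injective _≡_ _≡_ f → (∀ i → f i ∈ p) → ∣ p ∣ ≡ m → Range f ≐ (_∈ p)
injective⇒Range≐ {m} {n} {f} p inj f∈p ∣p∣≡m = (λ { (i , refl) → f∈p i }) , covered
  where
  covered : ∀ {x} → x ∈ p → Range f x
  covered {x} x∈p with any? (λ i → f i ≟ x)
  ... | yes x∈f = x∈f
  ... | no  x∉f = contradiction
    (ℕ.≤-trans (injective⇒≤∣∣ p (∷-injective inj x∉f) λ { zero → x∈p ; (suc i) → f∈p i }) (ℕ.≤-reflexive ∣p∣≡m))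
    ℕ.1+n≰n

∪｛｝≐∪⁅⁆ : ∀ {n} {P : Pred (Fin n) 0ℓ} {p : Subset n} {x} →
          P ≐ (_∈ p) → (P Pred.∪ ｛ x ｝) ≐ (_∈ p ∪ ⁅ x ⁆)
∪｛｝≐∪⁅⁆ {P = P} {p} {x} (P⊆p , p⊆P) = to , from
  where
  to : ∀ {y} → (P Pred.∪ ｛ x ｝) y → y ∈ p ∪ ⁅ x ⁆
  to (inj₁ Py)   = x∈p∪q⁺ (inj₁ (P⊆p Py))
  to (inj₂ refl) = x∈p∪q⁺ (inj₂ (x∈⁅x⁆ x))

  from : ∀ {y} → y ∈ p ∪ ⁅ x ⁆ → (P Pred.∪ ｛ x ｝) y
  from = Sum.map p⊆P (sym ∘ x∈⁅y⁆⇒x≡y x) ∘ x∈p∪q⁻ p ⁅ x ⁆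

theorem2p2 : ∀ {n : ℕ} (G : Graph n) (k : ℕ) → 1 ≤ k →
    (S₁ S₂ : Subset n) → Empty (S₁ ∩ S₂) → Linked G k S₁ S₂ →
    (T₁ T₂ : Subset n) → T₁ ⊆ S₁ → T₂ ⊆ S₂ →
    ∣ T₁ ∣ ≡ k ∸ 1 → ∣ T₂ ∣ ≡ k ∸ 1 → Linked G (k ∸ 1) T₁ T₂ →
    ∃[ s₁ ] ∃[ s₂ ] (s₁ ∈ S₁ ─ T₁ × s₂ ∈ S₂ ─ T₂ ×
    Linked G k (T₁ ∪ ⁅ s₁ ⁆) (T₂ ∪ ⁅ s₂ ⁆))
theorem2p2 {n} G (suc m) (s≤s _) S₁ S₂ _ L T₁ T₂ _ _ ∣T₁∣≡m ∣T₂∣≡m K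
  with s₁ , s₂ , ((i , refl) , s₁∉α) , ((j , refl) , s₂∉β) , M ←
    exchange G (linked-source-injective G L) (linked⇒matching G K) (linked⇒matching G L) =
  s₁ , s₂ ,
  -- As a source of `L`, `s₁` is in `S₁`; it is no source of `K`, and these exhaust `T₁`. The
  -- targets behave in the same way.
  x∈p∧x∉q⇒x∈p─q (Linked.source∈ L i) (s₁∉α ∘ proj₂ sources) ,
  x∈p∧x∉q⇒x∈p─q (Linked.target∈ L j) (s₂∉β ∘ proj₂ targets) ,
  matching⇒linked G (matching-resp-≐ G (∪｛｝≐∪⁅⁆ sources) (∪｛｝≐∪⁅⁆ targets) M)
    -- The new paths start at `s₁` and at the old sources of `K`; their targets may be paired
    -- differently than in `K`.
    (s₁ Vector.∷ α) (∷-injective (linked-source-injective G K) s₁∉α)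
    λ { zero → x∈p∪q⁺ (inj₂ (x∈⁅x⁆ s₁)) ; (suc i) → x∈p∪q⁺ (inj₁ (Linked.source∈ K i)) }
  where
  α : Fin m → Fin n
  α i = Path.source (Linked.path K i)

  sources : Range α ≐ (_∈ T₁)
  sources = injective⇒Range≐ T₁ (linked-source-injective G K) (Linked.source∈ K) ∣T₁∣≡m

  targets : Range (λ i → Path.target (Linked.path K i)) ≐ (_∈ T₂)
  targets = injective⇒Range≐ T₂ (linked-target-injective G K) (Linked.target∈ K) ∣T₂∣≡m
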